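{- Let $Sp(K,S)$ be a split graph with $|K|=k\ge 2$ and biadjacency matrix $R$, so that \[A(Sp)=\begin{pmatrix} J-I & R\\ R^t & 0\end{pmatrix},\] and let $r=R^t\mathbf{1}$. Then \[\det(Sp)=(-1)^{k-1}\left((k-1)\det(R^tR)-r^t\operatorname{adj}(R^tR)\,r\right).\]
   Context: Graphs are finite and simple. A split graph is a graph $Sp$ whose vertex set is a disjoint union of a clique $K$ and an independent set $S$; the pair $(K,S)$ is called an s-partition, and $Sp(K,S)$ denotes $Sp$ together with this s-partition. Both $K$ and $S$ are assumed nonempty. The vertices are ordered as $(K,S)$; $J$ is an all-ones matrix, $I$ the identity, and $R$ is the $|K|\times|S|$ $0/1$ biadjacency matrix ($R_{uv}=1$ iff $u\in K$ and $v\in S$ are adjacent). $\mathbf{1}$ is the all-ones column vector, $\operatorname{adj}$ denotes the adjugate matrix, and $\det(Sp)$ means $\det(A(Sp))$. -}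

module Defs where

open import Level using (0ℓ)
open import Data.Nat.Base as ℕ using (ℕ; zero; suc)
open import Data.Integer.Base using (ℤ; 0ℤ; 1ℤ; -1ℤ; _-_; _*_; _^_)
open import Data.Integer.Properties using (+-*-semiring)
open import Data.Fin.Base using (Fin; zero; suc; toℕ; splitAt)
open import Data.Fin.Properties using (_≟_)
open import Data.Bool.Base using (if_then_else_)
open import Data.Sum.Base using (_⊎_; inj₁; inj₂; [_,_]′)
open import Data.Vec.Functional using (Vector; map; removeAt; replicate)
open import Algebra.Properties.Semiring.Sum +-*-semiring using (sum)
open import Function.Base using (flip; _∘_)
open import Function.Bundles using (_↔_; Inverse)
open import Relation.Binary.Core using (Rel)
open import Relation.Binary.Definitions using (Symmetric; Decidable)
open import Relation.Binary.PropositionalEquality using (_≡_; _≢_; refl)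
open import Relation.Nullary.Decidable using (does)
open import Relation.Nullary.Negation using (¬_; contradiction)
open import Relation.Nullary using (yes; no)

Matrix : ℕ → ℕ → Set
Matrix m n = Vector (Vector ℤ n) m

infixl 7 _⊠_ _⊡_ _∙_
infixl 6 _⊟_
infix  8 _ᵗ

_ᵗ : ∀ {m n} → Matrix m n → Matrix n m
M ᵗ = flip M

_∙_ : ∀ {n} → Vector ℤ n → Vector ℤ n → ℤ
u ∙ v = sum (λ i → u i * v i)

_⊡_ : ∀ {m n} → Matrix m n → Vector ℤ n → Vector ℤ m
(M ⊡ v) i = M i ∙ v

_⊠_ : ∀ {l m n} → Matrix l m → Matrix m n → Matrix l n
(M ⊠ N) i j = M i ∙ (N ᵗ) j

_⊟_ : ∀ {m n} → Matrix m n → Matrix m n → Matrix m n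
(M ⊟ N) i j = M i j - N i j

𝟏 : ∀ {n} → Vector ℤ n
𝟏 = replicate _ 1ℤ

allOnes : ∀ {m n} → Matrix m n
allOnes i j = 1ℤ

allZeros : ∀ {m n} → Matrix m n
allZeros i j = 0ℤ

identity : ∀ {n} → Matrix n n
identity i j = if does (i ≟ j) then 1ℤ else 0ℤ

blocks : ∀ {m₁ m₂ n₁ n₂} →
         Matrix m₁ n₁ → Matrix m₁ n₂ →
         Matrix m₂ n₁ → Matrix m₂ n₂ →
         Matrix (m₁ ℕ.+ m₂) (n₁ ℕ.+ n₂)
blocks {m₁} {m₂} {n₁} A B C D i j =
  [ (λ i₁ → [ A i₁ , B i₁ ]′ (splitAt n₁ j))
  , (λ i₂ → [ C i₂ , D i₂ ]′ (splitAt n₁ j))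
  ]′ (splitAt m₁ i)

deleteRowCol : ∀ {m n} → Matrix (suc m) (suc n) → Fin (suc m) → Fin (suc n) → Matrix m n
deleteRowCol M i j = map (λ row → removeAt row j) (removeAt M i)

-- Cofactor expansion along the first row; the empty determinant is 1.
det : ∀ {n} → Matrix n n → ℤ
det {zero}  M = 1ℤ
det {suc n} M = sum (λ j → -1ℤ ^ toℕ j * M zero j * det (deleteRowCol M zero j))

-- The transpose of the cofactor matrix.
adj : ∀ {n} → Matrix n n → Matrix n n
adj {suc n} M i j = -1ℤ ^ (toℕ i ℕ.+ toℕ j) * det (deleteRowCol M j i)

record Graph (n : ℕ) : Set₁ where
  field
    _~_         : Rel (Fin n) 0ℓ
    _~?_        : Decidable _~_
    symmetric   : Symmetric _~_
    irreflexive : ∀ v → ¬ (v ~ v)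

  adjacency : Fin n → Fin n → ℤ
  adjacency u v = if does (u ~? v) then 1ℤ else 0ℤ

-- An s-partition (K , S) with |K| = k and |S| = s, both parts listed in some
-- order.  The bijection says that K and S are disjoint and cover the vertices.
record SPartition {n : ℕ} (G : Graph n) (k s : ℕ) : Set where
  open Graph G
  field
    vertices : (Fin k ⊎ Fin s) ↔ Fin n

  vertex : Fin k ⊎ Fin s → Fin n
  vertex = Inverse.to vertices

  inK : Fin k → Fin n
  inK = vertex ∘ inj₁

  inS : Fin s → Fin n
  inS = vertex ∘ inj₂

  field
    K-nonempty    : 1 ℕ.≤ k
    S-nonempty    : 1 ℕ.≤ s
    K-clique      : ∀ {i j} → i ≢ j → inK i ~ inK j
    S-independent : ∀ i j → ¬ (inS i ~ inS j)

module _ {n k s : ℕ} {G : Graph n} (Sp : SPartition G k s) where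
  open Graph G
  open SPartition Sp

  biadjacencyMatrix : Matrix k s
  biadjacencyMatrix u v = adjacency (inK u) (inS v)

  -- The vertices are ordered with K first, then S.
  adjacencyMatrix : Matrix (k ℕ.+ s) (k ℕ.+ s)
  adjacencyMatrix i j = adjacency (vertex (splitAt k i)) (vertex (splitAt k j))

  adjacencyMatrix-blocks : let R = biadjacencyMatrix in
    ∀ i j → adjacencyMatrix i j ≡ blocks (allOnes ⊟ identity) R (R ᵗ) allZeros i j
  adjacencyMatrix-blocks i j with splitAt k i | splitAt k j
  ... | inj₁ u | inj₂ v = refl
  ... | inj₁ u | inj₁ v with u ≟ v | inK u ~? inK v
  ...   | yes refl | yes e = contradiction e (irreflexive _)
  ...   | yes refl | no  _ = refl
  ...   | no  _    | yes _ = refl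
  ...   | no  u≢v  | no ¬e = contradiction (K-clique u≢v) ¬e
  adjacencyMatrix-blocks i j | inj₂ u | inj₁ v with inS u ~? inK v | inK v ~? inS u
  ...   | yes _ | yes _ = refl
  ...   | no  _ | no  _ = refl
  ...   | yes e | no ¬e = contradiction (symmetric e) ¬e
  ...   | no ¬e | yes e = contradiction (symmetric e) ¬e
  adjacencyMatrix-blocks i j | inj₂ u | inj₂ v with inS u ~? inS v
  ...   | yes e = contradiction e (S-independent u v)
  ...   | no  _ = refl

-- Write J - I = -I + 𝟏𝟏ᵗ and border A(Sp) so that the rank-one term becomes a pivot:
--
--                    ( -1  𝟏ᵗ  0 )
--   det A(Sp) = -det (  𝟏  -I  R ) .
--                    (  0  Rᵗ  0 )
--
-- Eliminating the block -I instead leaves (-1)ᵏ times the determinant of the matrix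
-- with rows (k - 1 , rᵗ) and (r , RᵗR), which is (k - 1) det(RᵗR) - rᵗ adj(RᵗR) r.
-- Both eliminations use a pivot equal to -1, so no division is needed.
module Submission where

open import Defs
open import Data.Nat.Base as ℕ using (ℕ; zero; suc; _≤_; _∸_; s≤s)
open import Data.Integer.Base using (ℤ; +_; 0ℤ; -1ℤ; 1ℤ; _+_; _-_; -_; _*_; _^_)
open import Data.Integer.Properties using (+-*-semiring; +-identityʳ; *-identityˡ; *-comm; neg-involutive; ^-distribˡ-+-*)
open import Data.Integer.Tactic.RingSolver using (solve-∀)
open import Data.Fin.Base using (Fin; zero; suc; toℕ; splitAt; punchIn)
open import Data.Sum.Base using (_⊎_; inj₁; inj₂; map₁; map₂)
open import Data.Vec.Functional using (Vector; _∷_)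
open import Algebra.Properties.Semiring.Sum +-*-semiring using (sum; sum-cong-≗; ∑-distrib-+; ∑-comm; *-distribˡ-sum)
open import Function.Base using (_∘_)
open import Relation.Binary.PropositionalEquality using (_≡_; refl; sym; trans; cong; cong₂; module ≡-Reasoning)

open ≡-Reasoning

-- Entrywise equality and auxiliary matrices.

infix 4 _≋_

-- Matrices are functions, so equality is taken entrywise and carried through `det` by `det-cong`,
-- without function extensionality.
_≋_ : ∀ {m n} → Matrix m n → Matrix m n → Set
M ≋ N = ∀ i j → M i j ≡ N i j

sign : ∀ {n} → Fin n → ℤ
sign i = -1ℤ ^ toℕ i

tailCols : ∀ {m n} → Matrix m (suc n) → Matrix m n
tailCols M i = M i ∘ suc

border : ∀ {m n} → ℤ → Vector ℤ n → Vector ℤ m → Matrix m n → Matrix (suc m) (suc n)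
border a u v N = (a ∷ u) ∷ (λ i → v i ∷ N i)

addOuter : ∀ {m n} → Matrix m n → Vector ℤ m → Vector ℤ n → Matrix m n
addOuter D c b i j = D i j + c i * b j

sum-+-* : ∀ {n} x (f g : Vector ℤ n) → sum (λ i → f i + x * g i) ≡ sum f + x * sum g
sum-+-* x f g = trans (∑-distrib-+ f (λ i → x * g i)) (cong (λ z → sum f + z) (sym (*-distribˡ-sum x g)))

-- Column expansion, transposition, and swaps of the first two indices.

det-cong : ∀ {n} {M N : Matrix n n} → M ≋ N → det M ≡ det N
det-cong {zero}  M≋N = refl
det-cong {suc n} M≋N = sum-cong-≗ λ j →
  cong₂ _*_ (cong (sign j *_) (M≋N zero j)) (det-cong (λ a b → M≋N (suc a) (punchIn j b)))

-- The sign sits on the outer sum, as it does in an iterated cofactor expansion.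
double-sum-swap : ∀ {m n} (σ a : Vector ℤ n) (τ b : Vector ℤ m) (D : Matrix m n) →
  sum (λ j → -1ℤ * σ j * a j * sum (λ i → τ i * b i * D i j)) ≡
  sum (λ i → -1ℤ * τ i * b i * sum (λ j → σ j * a j * D i j))
double-sum-swap σ a τ b D = begin
  sum (λ j → -1ℤ * σ j * a j * sum (λ i → τ i * b i * D i j))
    ≡⟨ sum-cong-≗ (λ j → *-distribˡ-sum (-1ℤ * σ j * a j) (λ i → τ i * b i * D i j)) ⟩
  sum (λ j → sum (λ i → -1ℤ * σ j * a j * (τ i * b i * D i j)))
    ≡⟨ ∑-comm (λ j i → -1ℤ * σ j * a j * (τ i * b i * D i j)) ⟩
  sum (λ i → sum (λ j → -1ℤ * σ j * a j * (τ i * b i * D i j)))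
    ≡⟨ sum-cong-≗ (λ i → sum-cong-≗ (λ j → regroup (σ j) (a j) (τ i) (b i) (D i j))) ⟩
  sum (λ i → sum (λ j → -1ℤ * τ i * b i * (σ j * a j * D i j)))
    ≡⟨ sum-cong-≗ (λ i → *-distribˡ-sum (-1ℤ * τ i * b i) (λ j → σ j * a j * D i j)) ⟨
  sum (λ i → -1ℤ * τ i * b i * sum (λ j → σ j * a j * D i j)) ∎
  where
  regroup : ∀ s x t y d → -1ℤ * s * x * (t * y * d) ≡ -1ℤ * t * y * (s * x * d)
  regroup = solve-∀

-- Apart from the corner term, expand by the first row and then, inductively, each minor by its
-- first column. Both orders of expansion reach the same minors `D i j`, so exchanging the sums
-- leaves an inner sum that is the first-row expansion of `deleteRowCol M (suc i) zero`.
det-firstColumn : ∀ {n} (M : Matrix (suc n) (suc n)) →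
  det M ≡ sum (λ i → sign i * M i zero * det (deleteRowCol M i zero))
det-firstColumn {zero}  M = refl
det-firstColumn {suc n} M = cong (λ z → sign {suc n} zero * M zero zero * det (deleteRowCol M zero zero) + z) (begin
  sum (λ j → -1ℤ * sign j * M zero (suc j) * det (deleteRowCol M zero (suc j)))
    ≡⟨ sum-cong-≗ (λ j → cong (-1ℤ * sign j * M zero (suc j) *_) (det-firstColumn (deleteRowCol M zero (suc j)))) ⟩
  sum (λ j → -1ℤ * sign j * M zero (suc j) * sum (λ i → sign i * M (suc i) zero * det (D i j)))
    ≡⟨ double-sum-swap sign (λ j → M zero (suc j)) sign (λ i → M (suc i) zero) (λ i j → det (D i j)) ⟩
  sum (λ i → -1ℤ * sign i * M (suc i) zero * det (deleteRowCol M (suc i) zero)) ∎)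
  where
  D : Fin (suc n) → Fin (suc n) → Matrix n n
  D i j a b = M (suc (punchIn i a)) (suc (punchIn j b))

-- The first-row expansion of `M ᵗ` is the first-column expansion of `M` with transposed minors.
det-transpose : ∀ {n} (M : Matrix n n) → det (M ᵗ) ≡ det M
det-transpose {zero}  M = refl
det-transpose {suc n} M = trans
  (sum-cong-≗ (λ j → cong (sign j * M j zero *_) (det-transpose (deleteRowCol M j zero))))
  (sym (det-firstColumn M))

swap₀₁ : ∀ {n} → Fin (suc (suc n)) → Fin (suc (suc n))
swap₀₁ zero          = suc zero
swap₀₁ (suc zero)    = zero
swap₀₁ (suc (suc i)) = suc (suc i)

-- In the first-column expansion the first two minors trade places under opposite signs, and every
-- later minor still contains both swapped rows, so induction applies.
det-swapRows : ∀ {n} (M : Matrix (suc (suc n)) (suc (suc n))) → det (M ∘ swap₀₁) ≡ - det M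
det-swapRows {n} M = begin
  det M′
    ≡⟨ det-firstColumn M′ ⟩
  1ℤ * q * det (deleteRowCol M′ zero zero)
    + (-1ℤ * p * det (deleteRowCol M′ (suc zero) zero)
    + sum (λ i → x i * det (deleteRowCol M′ (suc (suc i)) zero)))
    ≡⟨ cong₂ (λ y z → 1ℤ * q * y + (-1ℤ * p * z + sum (λ i → x i * det (deleteRowCol M′ (suc (suc i)) zero))))
         (det-cong minor₀) (det-cong minor₁) ⟩
  1ℤ * q * Q + (-1ℤ * p * P + sum (λ i → x i * det (deleteRowCol M′ (suc (suc i)) zero)))
    ≡⟨ cong (λ z → 1ℤ * q * Q + (-1ℤ * p * P + z)) (begin
         sum (λ i → x i * det (deleteRowCol M′ (suc (suc i)) zero))
           ≡⟨ sum-cong-≗ (λ i → trans (cong (x i *_) (minor₂ M i)) (x*-d (x i) _)) ⟩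
         sum (λ i → -1ℤ * (x i * det (deleteRowCol M (suc (suc i)) zero)))
           ≡⟨ *-distribˡ-sum -1ℤ (λ i → x i * det (deleteRowCol M (suc (suc i)) zero)) ⟨
         -1ℤ * T ∎) ⟩
  1ℤ * q * Q + (-1ℤ * p * P + -1ℤ * T)
    ≡⟨ collect p P q Q T ⟩
  - (1ℤ * p * P + (-1ℤ * q * Q + T))
    ≡⟨ cong -_ (det-firstColumn M) ⟨
  - det M ∎
  where
  M′ = M ∘ swap₀₁
  p = M zero zero
  q = M (suc zero) zero
  P = det (deleteRowCol M zero zero)
  Q = det (deleteRowCol M (suc zero) zero)

  x : Vector ℤ n
  x i = sign (suc (suc i)) * M (suc (suc i)) zero

  T = sum (λ i → x i * det (deleteRowCol M (suc (suc i)) zero))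

  minor₀ : deleteRowCol M′ zero zero ≋ deleteRowCol M (suc zero) zero
  minor₀ zero    b = refl
  minor₀ (suc a) b = refl

  minor₁ : deleteRowCol M′ (suc zero) zero ≋ deleteRowCol M zero zero
  minor₁ zero    b = refl
  minor₁ (suc a) b = refl

  -- A row beyond the first two exists only in size at least three, so the minor still has two rows
  -- to swap.
  minor₂ : ∀ {n} (M : Matrix (suc (suc n)) (suc (suc n))) (i : Fin n) →
    det (deleteRowCol (M ∘ swap₀₁) (suc (suc i)) zero) ≡ - det (deleteRowCol M (suc (suc i)) zero)
  minor₂ {suc n} M i = trans (det-cong commute) (det-swapRows (deleteRowCol M (suc (suc i)) zero))
    where
    commute : deleteRowCol (M ∘ swap₀₁) (suc (suc i)) zero ≋ deleteRowCol M (suc (suc i)) zero ∘ swap₀₁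
    commute zero          b = refl
    commute (suc zero)    b = refl
    commute (suc (suc a)) b = refl

  x*-d : ∀ x d → x * - d ≡ -1ℤ * (x * d)
  x*-d = solve-∀

  collect : ∀ p P q Q T →
    1ℤ * q * Q + (-1ℤ * p * P + -1ℤ * T) ≡ - (1ℤ * p * P + (-1ℤ * q * Q + T))
  collect = solve-∀

-- The two sign changes cancel. This brings a diagonal pivot from index one to index zero.
det-swapRowsCols : ∀ {n} (M : Matrix (suc (suc n)) (suc (suc n))) →
  det (λ i j → M (swap₀₁ i) (swap₀₁ j)) ≡ det M
det-swapRowsCols M = begin
  det (λ i j → M (swap₀₁ i) (swap₀₁ j)) ≡⟨ det-swapRows N ⟩
  - det N                               ≡⟨ cong -_ (det-transpose N) ⟨
  - det ((M ᵗ) ∘ swap₀₁)                ≡⟨ cong -_ (det-swapRows (M ᵗ)) ⟩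
  - - det (M ᵗ)                         ≡⟨ neg-involutive (det (M ᵗ)) ⟩
  det (M ᵗ)                             ≡⟨ det-transpose M ⟩
  det M                                 ∎
  where
  N = λ i j → M i (swap₀₁ j)

-- Rank-one updates and elimination of a pivot equal to -1.

-- Expanding the first row of D + c bᵗ reduces the first identity to smaller sizes;
-- expanding the first column reduces the second one to the first.
mutual
  det-addOuter : ∀ {n} (D : Matrix n n) (c b : Vector ℤ n) →
    det (addOuter D c b) ≡ det D - det (border 0ℤ b c D)
  det-addOuter {zero}  D c b = refl
  det-addOuter {suc n} D c b = begin
    sum (λ j → sign j * (D zero j + c₀ * b j) * det (S j))
      ≡⟨ sum-cong-≗ (λ j → distrib (sign j) (D zero j) c₀ (b j) (det (S j))) ⟩
    sum (λ j → sign j * D zero j * det (S j) + c₀ * (sign j * b j * det (S j)))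
      ≡⟨ sum-+-* c₀ (λ j → sign j * D zero j * det (S j)) (λ j → sign j * b j * det (S j)) ⟩
    sum (λ j → sign j * D zero j * det (S j)) + c₀ * det (b ∷ addOuter (D ∘ suc) (c ∘ suc) b)
      ≡⟨ cong₂ (λ y z → y + c₀ * z)
           (begin
             sum (λ j → sign j * D zero j * det (S j))
               ≡⟨ sum-cong-≗ (λ j → trans
                    (cong (sign j * D zero j *_) (det-addOuter (minor j) (c ∘ suc) (b ∘ punchIn j)))
                    (distrib-minus (sign j * D zero j) (det (minor j)) (det (B j)))) ⟩
             sum (λ j → sign j * D zero j * det (minor j) + -1ℤ * (sign j * D zero j * det (B j)))
               ≡⟨ sum-+-* -1ℤ (λ j → sign j * D zero j * det (minor j)) (λ j → sign j * D zero j * det (B j)) ⟩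
             det D + -1ℤ * Y ∎)
           -- Below a first row `b`, the outer product only adds multiples of that row.
           (det-∷-addOuter (D ∘ suc) (c ∘ suc) b) ⟩
    det D + -1ℤ * Y + c₀ * E
      ≡⟨ collect (det D) Y c₀ E ⟩
    det D - - (1ℤ * c₀ * E + -1ℤ * Y)
      -- Once the border row is moved below the first row of `D`, the first-row expansion consists
      -- of the `c₀` term and the terms of `Y`.
      ≡⟨ cong (λ z → det D - - z) swapped ⟨
    det D - - det (border 0ℤ b c D ∘ swap₀₁)
      ≡⟨ cong (λ z → det D - - z) (det-swapRows (border 0ℤ b c D)) ⟩
    det D - - - det (border 0ℤ b c D)
      ≡⟨ cong (λ z → det D - z) (neg-involutive (det (border 0ℤ b c D))) ⟩
    det D - det (border 0ℤ b c D) ∎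
    where
    c₀ = c zero
    E = det (b ∷ (D ∘ suc))

    minor S : Fin (suc n) → Matrix n n
    minor j = deleteRowCol D zero j
    S j = addOuter (minor j) (c ∘ suc) (b ∘ punchIn j)

    B : Fin (suc n) → Matrix (suc n) (suc n)
    B j = border 0ℤ (b ∘ punchIn j) (c ∘ suc) (minor j)

    Y = sum (λ j → sign j * D zero j * det (B j))

    B′ = border 0ℤ b c D ∘ swap₀₁

    minor₀ : deleteRowCol B′ zero zero ≋ b ∷ (D ∘ suc)
    minor₀ zero    l = refl
    minor₀ (suc a) l = refl

    minor₊ : ∀ j → deleteRowCol B′ zero (suc j) ≋ B j
    minor₊ j zero    zero    = refl
    minor₊ j zero    (suc l) = refl
    minor₊ j (suc a) zero    = refl
    minor₊ j (suc a) (suc l) = refl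

    pull-sign : ∀ s d y → -1ℤ * s * d * y ≡ -1ℤ * (s * d * y)
    pull-sign = solve-∀

    swapped : det B′ ≡ 1ℤ * c₀ * E + -1ℤ * Y
    swapped = cong₂ (λ y z → 1ℤ * c₀ * y + z) (det-cong minor₀) (begin
      sum (λ j → -1ℤ * sign j * D zero j * det (deleteRowCol B′ zero (suc j)))
        ≡⟨ sum-cong-≗ (λ j → trans
             (cong (-1ℤ * sign j * D zero j *_) (det-cong (minor₊ j)))
             (pull-sign (sign j) (D zero j) (det (B j)))) ⟩
      sum (λ j → -1ℤ * (sign j * D zero j * det (B j)))
        ≡⟨ *-distribˡ-sum -1ℤ (λ j → sign j * D zero j * det (B j)) ⟨
      -1ℤ * Y ∎)

    distrib : ∀ s d c b x → s * (d + c * b) * x ≡ s * d * x + c * (s * b * x)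
    distrib = solve-∀

    distrib-minus : ∀ s x y → s * (x - y) ≡ s * x + -1ℤ * (s * y)
    distrib-minus = solve-∀

    collect : ∀ d y c e → d + -1ℤ * y + c * e ≡ d - - (1ℤ * c * e + -1ℤ * y)
    collect = solve-∀

  det-∷-addOuter : ∀ {n} (D : Matrix n (suc n)) (c : Vector ℤ n) (b : Vector ℤ (suc n)) →
    det (b ∷ addOuter D c b) ≡ det (b ∷ D)
  det-∷-addOuter {zero} D c b = refl
  det-∷-addOuter {suc n} D c b = begin
    det L
      ≡⟨ det-firstColumn L ⟩
    1ℤ * b₀ * det (addOuter D′ c b′) + sum (λ i → t i * (D i zero + c i * b₀) * det (deleteRowCol L (suc i) zero))
      ≡⟨ cong₂ (λ y z → 1ℤ * b₀ * y + z)
           (trans (det-addOuter D′ c b′) (cong (λ z → det D′ - z) bordered))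
           (begin
             sum (λ i → t i * (D i zero + c i * b₀) * det (deleteRowCol L (suc i) zero))
               ≡⟨ sum-cong-≗ (λ i → trans
                    (cong (t i * (D i zero + c i * b₀) *_)
                      (trans (det-cong (minor-L i))
                        (det-∷-addOuter (λ a → D′ (punchIn i a)) (c ∘ punchIn i) b′)))
                    (distrib (t i) (D i zero) (c i) b₀ (E i))) ⟩
             sum (λ i → t i * D i zero * E i + b₀ * (t i * c i * E i))
               ≡⟨ sum-+-* b₀ (λ i → t i * D i zero * E i) (λ i → t i * c i * E i) ⟩
             X + b₀ * Y ∎) ⟩
    1ℤ * b₀ * (det D′ - (1ℤ * 0ℤ * det D′ + Y)) + (X + b₀ * Y)
      -- The rank-one correction of the corner minor cancels the contribution of the column entries
      -- `c i * b₀`.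
      ≡⟨ cancel b₀ (det D′) X Y ⟩
    1ℤ * b₀ * det D′ + X
      ≡⟨ cong (λ z → 1ℤ * b₀ * det D′ + z)
           (sum-cong-≗ (λ i → cong (t i * D i zero *_) (det-cong (minor-∷ i)))) ⟨
    1ℤ * b₀ * det D′ + sum (λ i → t i * D i zero * det (deleteRowCol (b ∷ D) (suc i) zero))
      ≡⟨ det-firstColumn (b ∷ D) ⟨
    det (b ∷ D) ∎
    where
    L = b ∷ addOuter D c b
    b₀ = b zero
    b′ = b ∘ suc
    D′ = tailCols D
    B = border 0ℤ b′ c D′

    t E : Vector ℤ (suc n)
    t i = sign (suc i)
    E i = det (b′ ∷ (λ a → D′ (punchIn i a)))

    X = sum (λ i → t i * D i zero * E i)
    Y = sum (λ i → t i * c i * E i)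

    minor-L : ∀ i → deleteRowCol L (suc i) zero ≋ b′ ∷ addOuter (λ a → D′ (punchIn i a)) (c ∘ punchIn i) b′
    minor-L i zero    l = refl
    minor-L i (suc a) l = refl

    minor-∷ : ∀ i → deleteRowCol (b ∷ D) (suc i) zero ≋ b′ ∷ (λ a → D′ (punchIn i a))
    minor-∷ i zero    l = refl
    minor-∷ i (suc a) l = refl

    minor-B : ∀ i → deleteRowCol B (suc i) zero ≋ b′ ∷ (λ a → D′ (punchIn i a))
    minor-B i zero    l = refl
    minor-B i (suc a) l = refl

    bordered : det B ≡ 1ℤ * 0ℤ * det D′ + Y
    bordered = trans (det-firstColumn B)
      (cong (λ z → 1ℤ * 0ℤ * det D′ + z)
        (sum-cong-≗ (λ i → cong (t i * c i *_) (det-cong (minor-B i)))))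

    distrib : ∀ t d c b e → t * (d + c * b) * e ≡ t * d * e + b * (t * c * e)
    distrib = solve-∀

    cancel : ∀ b d x y → 1ℤ * b * (d - (1ℤ * 0ℤ * d + y)) + (x + b * y) ≡ 1ℤ * b * d + x
    cancel = solve-∀

-- The matrices `M` and `B` differ only in the corner, -1 against 0, so their first-column
-- expansions share the sum `T`. Hence `det M` is `- (det D - det B)`, which `det-addOuter` turns
-- into the Schur complement of the pivot.
det-pivot₀ : ∀ {n} (M : Matrix (suc n) (suc n)) → M zero zero ≡ -1ℤ →
  det M ≡ - det (λ i j → M (suc i) (suc j) + M (suc i) zero * M zero (suc j))
det-pivot₀ {n} M pivot = begin
  det M
    ≡⟨ det-firstColumn M ⟩
  1ℤ * M zero zero * det D + T
    ≡⟨ cong (λ z → 1ℤ * z * det D + T) pivot ⟩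
  1ℤ * -1ℤ * det D + T
    ≡⟨ collect (det D) T ⟩
  - (det D - (1ℤ * 0ℤ * det D + T))
    ≡⟨ cong (λ z → - (det D - (1ℤ * 0ℤ * det D + z)))
         (sum-cong-≗ (λ i → cong (sign (suc i) * c i *_) (det-cong (minor i)))) ⟨
  - (det D - (1ℤ * 0ℤ * det D + sum (λ i → sign (suc i) * c i * det (deleteRowCol B (suc i) zero))))
    ≡⟨ cong (λ z → - (det D - z)) (det-firstColumn B) ⟨
  - (det D - det B)
    ≡⟨ cong -_ (det-addOuter D c b) ⟨
  - det (addOuter D c b) ∎
  where
  b c : Vector ℤ n
  b j = M zero (suc j)
  c i = M (suc i) zero

  D = deleteRowCol M zero zero
  B = border 0ℤ b c D
  T = sum (λ i → sign (suc i) * c i * det (deleteRowCol M (suc i) zero))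

  minor : ∀ i → deleteRowCol B (suc i) zero ≋ deleteRowCol M (suc i) zero
  minor i zero    l = refl
  minor i (suc a) l = refl

  collect : ∀ d t → 1ℤ * -1ℤ * d + t ≡ - (d - (1ℤ * 0ℤ * d + t))
  collect = solve-∀

det-pivot₁ : ∀ {n} (M : Matrix (suc (suc n)) (suc (suc n))) → M (suc zero) (suc zero) ≡ -1ℤ →
  det M ≡ - det (λ i j → M (swap₀₁ (suc i)) (swap₀₁ (suc j))
                         + M (swap₀₁ (suc i)) (suc zero) * M (suc zero) (swap₀₁ (suc j)))
det-pivot₁ M pivot = trans (sym (det-swapRowsCols M)) (det-pivot₀ (λ i j → M (swap₀₁ i) (swap₀₁ j)) pivot)

-- Elimination of a whole block -I.

negIdentityBlock : ∀ {k t} → Matrix t t → Matrix k t → Matrix t k → Fin k ⊎ Fin t → Fin k ⊎ Fin t → ℤ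
negIdentityBlock N U V (inj₁ i) (inj₁ j) = - identity i j
negIdentityBlock N U V (inj₁ i) (inj₂ j) = U i j
negIdentityBlock N U V (inj₂ i) (inj₁ j) = V i j
negIdentityBlock N U V (inj₂ i) (inj₂ j) = N i j

-- The border index comes first, as in the bordered matrix: 1 + (k + s) rather than k + (1 + s).
splitBordered : ∀ k {s} → Fin (suc (k ℕ.+ s)) → Fin k ⊎ Fin (suc s)
splitBordered k zero    = inj₂ zero
splitBordered k (suc i) = map₂ suc (splitAt k i)

-- Dropping index one, the first index of the block -I, leaves the same bordered order with a block
-- smaller by one, so the elimination can recurse.
splitBordered-suc : ∀ k {s} (i : Fin (suc (k ℕ.+ s))) →
  splitBordered (suc k) (swap₀₁ (suc i)) ≡ map₁ suc (splitBordered k i)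
splitBordered-suc k zero = refl
splitBordered-suc k (suc i) with splitAt k i
... | inj₁ u = refl
... | inj₂ v = refl

-- Each pivot of -I contributes a factor -1 and adds to `N` the outer product of a column of `V`
-- with the matching row of `U`. These outer products sum to `V ⊠ U`.
det-eliminate-negIdentity : ∀ {k s} (N : Matrix (suc s) (suc s)) (U : Matrix k (suc s)) (V : Matrix (suc s) k) →
  det (λ i j → negIdentityBlock N U V (splitBordered k i) (splitBordered k j))
  ≡ -1ℤ ^ k * det (λ i j → N i j + (V ⊠ U) i j)
det-eliminate-negIdentity {zero} N U V = trans (det-cong entry) (sym (*-identityˡ _))
  where
  entry : (λ i j → negIdentityBlock N U V (splitBordered 0 i) (splitBordered 0 j)) ≋ (λ i j → N i j + 0ℤ)
  entry zero    zero    = sym (+-identityʳ _)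
  entry zero    (suc j) = sym (+-identityʳ _)
  entry (suc i) zero    = sym (+-identityʳ _)
  entry (suc i) (suc j) = sym (+-identityʳ _)
det-eliminate-negIdentity {suc k} {s} N U V = begin
  det (λ i j → Z (splitBordered (suc k) i) (splitBordered (suc k) j))
    ≡⟨ det-pivot₁ (λ i j → Z (splitBordered (suc k) i) (splitBordered (suc k) j)) refl ⟩
  - det (λ i j → Z (ι i) (ι j) + Z (ι i) (inj₁ zero) * Z (inj₁ zero) (ι j))
    ≡⟨ cong -_ (det-cong (λ i j → trans
         (cong₂ (λ x y → Z x y + Z x (inj₁ zero) * Z (inj₁ zero) y) (splitBordered-suc k i) (splitBordered-suc k j))
         (step (splitBordered k i) (splitBordered k j)))) ⟩
  - det (λ i j → negIdentityBlock N′ (U ∘ suc) (tailCols V) (splitBordered k i) (splitBordered k j))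
    ≡⟨ cong -_ (det-eliminate-negIdentity N′ (U ∘ suc) (tailCols V)) ⟩
  - (-1ℤ ^ k * det (λ i j → N′ i j + (tailCols V ⊠ (U ∘ suc)) i j))
    ≡⟨ cong (λ z → - (-1ℤ ^ k * z)) (det-cong (λ i j →
         assoc (N i j) (V i zero * U zero j) ((tailCols V ⊠ (U ∘ suc)) i j))) ⟩
  - (-1ℤ ^ k * det (λ i j → N i j + (V ⊠ U) i j))
    ≡⟨ pull-sign (-1ℤ ^ k) _ ⟩
  -1ℤ * -1ℤ ^ k * det (λ i j → N i j + (V ⊠ U) i j) ∎
  where
  Z = negIdentityBlock N U V

  ι : Fin (suc (k ℕ.+ s)) → Fin (suc k) ⊎ Fin (suc s)
  ι i = splitBordered (suc k) (swap₀₁ (suc i))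

  N′ : Matrix (suc s) (suc s)
  N′ = addOuter N (λ i → V i zero) (U zero)

  x+0*y : ∀ x y → x + 0ℤ * y ≡ x
  x+0*y = solve-∀

  x+y*0 : ∀ x y → x + y * 0ℤ ≡ x
  x+y*0 = solve-∀

  -- Within -I the pivot row and column vanish off the diagonal, so only the block `N` changes.
  step : ∀ x y → Z (map₁ suc x) (map₁ suc y) + Z (map₁ suc x) (inj₁ zero) * Z (inj₁ zero) (map₁ suc y)
               ≡ negIdentityBlock N′ (U ∘ suc) (tailCols V) x y
  step (inj₁ u) (inj₁ v) = +-identityʳ _
  step (inj₁ u) (inj₂ j) = x+0*y (U (suc u) j) (U zero j)
  step (inj₂ i) (inj₁ v) = x+y*0 (V i (suc v)) (V i zero)
  step (inj₂ i) (inj₂ j) = refl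

  assoc : ∀ x y z → x + y + z ≡ x + (y + z)
  assoc = solve-∀

  pull-sign : ∀ p d → - (p * d) ≡ -1ℤ * p * d
  pull-sign = solve-∀

-- Bordered determinants and the adjugate.

-- Every minor of the first-column expansion outside the corner has first row `u`. Expanding by that
-- row and exchanging the sums collects, as the coefficient of `u j`, row `j` of the adjugate
-- applied to `v`.
det-border : ∀ {n} a (u v : Vector ℤ n) (N : Matrix n n) →
  det (border a u v N) ≡ a * det N - u ∙ (adj N ⊡ v)
det-border {zero}  a u v N = empty a
  where
  empty : ∀ a → 1ℤ * a * 1ℤ + 0ℤ ≡ a * 1ℤ - 0ℤ
  empty = solve-∀
det-border {suc n} a u v N = begin
  det B
    ≡⟨ det-firstColumn B ⟩
  1ℤ * a * det N + sum (λ i → -1ℤ * sign i * v i * det (deleteRowCol B (suc i) zero))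
    ≡⟨ cong (λ z → 1ℤ * a * det N + z) (begin
         sum (λ i → -1ℤ * sign i * v i * det (deleteRowCol B (suc i) zero))
           ≡⟨ sum-cong-≗ (λ i → cong (-1ℤ * sign i * v i *_) (det-cong (minor i))) ⟩
         sum (λ i → -1ℤ * sign i * v i * sum (λ j → sign j * u j * d i j))
           ≡⟨ double-sum-swap sign v sign u (λ j i → d i j) ⟩
         sum (λ j → -1ℤ * sign j * u j * sum (λ i → sign i * v i * d i j))
           ≡⟨ sum-cong-≗ (λ j → trans (regroup (sign j) (u j) _) (cong (λ z → -1ℤ * (u j * z)) (adj-row j))) ⟩
         sum (λ j → -1ℤ * (u j * (adj N ⊡ v) j))
           ≡⟨ *-distribˡ-sum -1ℤ (λ j → u j * (adj N ⊡ v) j) ⟨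
         -1ℤ * (u ∙ (adj N ⊡ v)) ∎) ⟩
  1ℤ * a * det N + -1ℤ * (u ∙ (adj N ⊡ v))
    ≡⟨ collect a (det N) (u ∙ (adj N ⊡ v)) ⟩
  a * det N - u ∙ (adj N ⊡ v) ∎
  where
  B = border a u v N

  d : Matrix (suc n) (suc n)
  d i j = det (deleteRowCol N i j)

  minor : ∀ i → deleteRowCol B (suc i) zero ≋ u ∷ (λ a → N (punchIn i a))
  minor i zero    l = refl
  minor i (suc a) l = refl

  regroup : ∀ s x y → -1ℤ * s * x * y ≡ -1ℤ * (x * (s * y))
  regroup = solve-∀

  commute : ∀ s t x y → s * (t * x * y) ≡ s * t * y * x
  commute = solve-∀

  adj-row : ∀ j → sign j * sum (λ i → sign i * v i * d i j) ≡ (adj N ⊡ v) j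
  adj-row j = begin
    sign j * sum (λ i → sign i * v i * d i j)
      ≡⟨ *-distribˡ-sum (sign j) (λ i → sign i * v i * d i j) ⟩
    sum (λ i → sign j * (sign i * v i * d i j))
      ≡⟨ sum-cong-≗ (λ i → trans (commute (sign j) (sign i) (v i) (d i j))
           (cong (λ z → z * d i j * v i) (sym (^-distribˡ-+-* -1ℤ (toℕ j) (toℕ i))))) ⟩
    (adj N ⊡ v) j ∎

  collect : ∀ a d q → 1ℤ * a * d + -1ℤ * q ≡ a * d - q
  collect = solve-∀

-- The two eliminations applied to the bordered adjacency matrix.

sum-ones : ∀ k → sum {k} (λ _ → 1ℤ * 1ℤ) ≡ + k
sum-ones zero    = refl
sum-ones (suc k) = cong (λ z → 1ℤ + z) (sum-ones k)

theorem8p3 : ∀ {n k s : ℕ} (G : Graph n) (Sp : SPartition G k s) → 2 ≤ k →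
    let R = biadjacencyMatrix Sp
        r = R ᵗ ⊡ 𝟏
    in det (adjacencyMatrix Sp)
       ≡ -1ℤ ^ (k ∸ 1) * ((+ k - 1ℤ) * det (R ᵗ ⊠ R) - r ∙ (adj (R ᵗ ⊠ R) ⊡ r))
theorem8p3 {k = suc k} {s} G Sp (s≤s _) = begin
  det (adjacencyMatrix Sp)
    ≡⟨ neg-involutive _ ⟨
  - - det (adjacencyMatrix Sp)
    ≡⟨ cong (λ z → - - z) (det-cong unborder) ⟨
  - - det (λ i j → X (suc i) (suc j) + X (suc i) zero * X zero (suc j))
    ≡⟨ cong -_ (det-pivot₀ X refl) ⟨
  - det X
    ≡⟨ cong -_ (det-eliminate-negIdentity N U V) ⟩
  - (-1ℤ * -1ℤ ^ k * det (λ i j → N i j + (V ⊠ U) i j))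
    -- The corner is the border pivot -1 plus the product of two all-ones vectors, one entry per
    -- vertex of the clique.
    ≡⟨ cong (λ z → - (-1ℤ * -1ℤ ^ k * z)) (trans (det-cong schur) (det-border (-1ℤ + + suc k) r r (R ᵗ ⊠ R))) ⟩
  - (-1ℤ * -1ℤ ^ k * ((-1ℤ + + suc k) * det (R ᵗ ⊠ R) - r ∙ (adj (R ᵗ ⊠ R) ⊡ r)))
    -- The clique has `suc k` vertices, so the outer minus sign leaves the exponent `k`, one less
    -- than the clique size.
    ≡⟨ signs (-1ℤ ^ k) (+ suc k) (det (R ᵗ ⊠ R)) (r ∙ (adj (R ᵗ ⊠ R) ⊡ r)) ⟩
  -1ℤ ^ k * ((+ suc k - 1ℤ) * det (R ᵗ ⊠ R) - r ∙ (adj (R ᵗ ⊠ R) ⊡ r)) ∎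
  where
  R = biadjacencyMatrix Sp
  r = R ᵗ ⊡ 𝟏

  N : Matrix (suc s) (suc s)
  N = border -1ℤ (λ _ → 0ℤ) (λ _ → 0ℤ) allZeros

  U : Matrix (suc k) (suc s)
  U u = 1ℤ ∷ R u

  V : Matrix (suc s) (suc k)
  V = 𝟏 ∷ R ᵗ

  -- Index zero is the border. Eliminating it restores the adjacency matrix, while eliminating -I
  -- leaves the bordered Gram matrix of `schur`.
  X : Matrix (suc (suc k ℕ.+ s)) (suc (suc k ℕ.+ s))
  X i j = negIdentityBlock N U V (splitBordered (suc k) i) (splitBordered (suc k) j)

  -x+1 : ∀ x → - x + 1ℤ * 1ℤ ≡ 1ℤ - x
  -x+1 = solve-∀

  unborder′ : ∀ i j → X (suc i) (suc j) + X (suc i) zero * X zero (suc j)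
            ≡ blocks (allOnes ⊟ identity) R (R ᵗ) allZeros i j
  unborder′ i j with splitAt (suc k) i | splitAt (suc k) j
  ... | inj₁ u | inj₁ v = -x+1 (identity u v)
  ... | inj₁ u | inj₂ v = +-identityʳ _
  ... | inj₂ u | inj₁ v = +-identityʳ _
  ... | inj₂ u | inj₂ v = refl

  unborder : (λ i j → X (suc i) (suc j) + X (suc i) zero * X zero (suc j)) ≋ adjacencyMatrix Sp
  unborder i j = trans (unborder′ i j) (sym (adjacencyMatrix-blocks Sp i j))

  0+ : ∀ x → 0ℤ + x ≡ x
  0+ = solve-∀

  schur : (λ i j → N i j + (V ⊠ U) i j) ≋ border (-1ℤ + + suc k) r r (R ᵗ ⊠ R)
  schur zero    zero    = cong (λ z → -1ℤ + z) (sum-ones (suc k))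
  -- Here the ones multiply from the left, whereas in `r` they stand on the right.
  schur zero    (suc j) = trans (0+ _) (sum-cong-≗ (λ l → *-comm 1ℤ (R l j)))
  schur (suc i) zero    = 0+ _
  schur (suc i) (suc j) = 0+ _

  signs : ∀ p k d q → - (-1ℤ * p * ((-1ℤ + k) * d - q)) ≡ p * ((k - 1ℤ) * d - q)
  signs = solve-∀
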